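{- If $w$ is a universal Lyndon word of degree $n$, then $\mathrm{MT}(w)$ is a Hamiltonian lex-code of degree $n$. Conversely, if $X\subseteq\Sigma_n^*$ is a Hamiltonian lex-code of degree $n$, then there exists a universal Lyndon word $w$ of degree $n$ such that $X=\mathrm{MT}(w)$.
   Context: $\Sigma_n=\{1,\ldots,n\}$, $\Sigma_n^*$ the set of words over it. For a word $w=a_1\cdots a_m$ a proper conjugate is $w_2w_1$ where $w=w_1w_2$ with $w_1,w_2$ nonempty. A total order on the alphabet induces the lexicographic order on words ($u$ is smaller than $v$ if $u$ is a proper prefix of $v$, or $u=zau'$, $v=zbv'$ with letters $a<b$). A word $w$ over $\Sigma_n$ is a Lyndon word if for some total order on $\Sigma_n$ it is strictly lexicographically smaller than each of its proper conjugates. A universal Lyndon word of degree $n$ is a word over $\Sigma_n$ of length $n!$ all of whose conjugates are Lyndon words. A cyclic factor of $w$ is a nonempty word $u$ with $|u|\le|w|$ that is a factor of $ww$. For a nonempty word $u$, with set of letters $\mathrm{alp}(u)$, $\triangleleft_u$ is the relation on $\Sigma_n$: $i\triangleleft_u j$ iff $i\in\mathrm{alp}(u)$ and either $j\notin\mathrm{alp}(u)$ or the first occurrence of $i$ in $u$ precedes that of $j$. $\mathrm{MT}(w)$ is the set of cyclic factors $u$ of $w$ such that $\triangleleft_u$ is a total order on $\Sigma_n$ and no proper factor $v$ of $u$ (nonempty, different from $u$) satisfies $\triangleleft_v=\triangleleft_u$. A set $X\subseteq\Sigma_n^*$ is a lex-code of degree $n$ if (1) for every $x\in X$ there exists a unique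 total order on $\Sigma_n$ for which $x$ is the lexicographic minimum of $X$, and (2) every proper prefix (nonempty prefix different from the word itself) of a word of $X$ is a prefix of at least two distinct words of $X$. A lex-code $X$ is Hamiltonian if the digraph with vertex set $X$ and edge set $S_X=\{(x,y)\in X\times X:\ x \text{ is a prefix of } ay \text{ for some } a\in\Sigma_n\}$ has a Hamiltonian cycle (a closed walk visiting every vertex exactly once).
   Formalization: The converse is stated for n ≥ 2 only: for n = 1 the set X = {ε} is a Hamiltonian lex-code of degree 1, but MT(w) never contains the empty word, so the converse fails there. -}

module Defs where

open import Data.Nat using (ℕ; zero; suc; _<_; _≤_; _!)
open import Data.Nat.DivMod using (_mod_)
open import Data.Fin using (Fin; toℕ; _≟_)
open import Data.List using (List; []; _∷_; _++_; length)
open import Data.List.Membership.Propositional using (_∈_; _∉_)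
open import Data.Product using (Σ; ∃; ∃-syntax; _×_; _,_)
open import Data.Sum using (_⊎_)
open import Relation.Nullary using (¬_; yes; no)
open import Relation.Binary.PropositionalEquality using (_≡_; _≢_)
open import Function.Definitions using (Injective)
open import Function.Bundles using (_⇔_)

Word : ℕ → Set
Word n = List (Fin n)

-- A total order on Σ_n, represented by its rank function: a < b iff rank a < rank b.
-- Injective rank functions Fin n → Fin n correspond bijectively to total orders.
Order : ℕ → Set
Order n = Fin n → Fin n

IsOrder : {n : ℕ} → Order n → Set
IsOrder r = Injective _≡_ _≡_ r

LtL : {n : ℕ} → Order n → Fin n → Fin n → Set
LtL r a b = toℕ (r a) < toℕ (r b)

Lex : {n : ℕ} → Order n → Word n → Word n → Set
Lex {n} r u v =
  (∃[ s ] (s ≢ [] × u ++ s ≡ v))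
  ⊎ (Σ (Word n) λ z → Σ (Fin n) λ a → Σ (Fin n) λ b → Σ (Word n) λ u′ → Σ (Word n) λ v′ →
       (u ≡ z ++ (a ∷ u′)) × (v ≡ z ++ (b ∷ v′)) × LtL r a b)

ProperConjugate : {n : ℕ} → Word n → Word n → Set
ProperConjugate {n} c w = Σ (Word n) λ w₁ → Σ (Word n) λ w₂ →
  w₁ ≢ [] × w₂ ≢ [] × w ≡ w₁ ++ w₂ × c ≡ w₂ ++ w₁

Conjugate : {n : ℕ} → Word n → Word n → Set
Conjugate {n} c w = Σ (Word n) λ w₁ → Σ (Word n) λ w₂ →
  w ≡ w₁ ++ w₂ × c ≡ w₂ ++ w₁

Lyndon : {n : ℕ} → Word n → Set
Lyndon {n} w = Σ (Order n) λ r → IsOrder r × (∀ c → ProperConjugate c w → Lex r w c)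

UniversalLyndon : (n : ℕ) → Word n → Set
UniversalLyndon n w = length w ≡ n ! × (∀ c → Conjugate c w → Lyndon c)

CyclicFactor : {n : ℕ} → Word n → Word n → Set
CyclicFactor {n} w u = u ≢ [] × length u ≤ length w ×
  (Σ (Word n) λ p → Σ (Word n) λ s → p ++ u ++ s ≡ w ++ w)

ProperFactor : {n : ℕ} → Word n → Word n → Set
ProperFactor {n} v u = v ≢ [] × v ≢ u ×
  (Σ (Word n) λ p → Σ (Word n) λ s → p ++ v ++ s ≡ u)

-- position (0-based) of the first occurrence of i in u (length u if absent)
firstOcc : {n : ℕ} → Fin n → Word n → ℕ
firstOcc i [] = zero
firstOcc i (a ∷ u) with i ≟ a
... | yes _ = zero
... | no  _ = suc (firstOcc i u)

Tri : {n : ℕ} → Word n → Fin n → Fin n → Set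
Tri u i j = i ∈ u × (j ∉ u ⊎ firstOcc i u < firstOcc j u)

IsStrictTotal : {n : ℕ} → (Fin n → Fin n → Set) → Set
IsStrictTotal {n} R =
  (∀ i → ¬ R i i)
  × (∀ i j k → R i j → R j k → R i k)
  × (∀ i j → i ≢ j → R i j ⊎ R j i)

SameTri : {n : ℕ} → Word n → Word n → Set
SameTri {n} v u = ∀ (i j : Fin n) → Tri v i j ⇔ Tri u i j

MT : {n : ℕ} → Word n → Word n → Set
MT w u = CyclicFactor w u × IsStrictTotal (Tri u)
         × (∀ v → ProperFactor v u → ¬ SameTri v u)

Prefix : {n : ℕ} → Word n → Word n → Set
Prefix u v = ∃[ s ] (u ++ s ≡ v)

ProperPrefix : {n : ℕ} → Word n → Word n → Set
ProperPrefix u v = u ≢ [] × u ≢ v × Prefix u v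

LexMin : {n : ℕ} → Order n → (Word n → Set) → Word n → Set
LexMin r X x = X x × (∀ y → X y → y ≡ x ⊎ Lex r x y)

LexCode : (n : ℕ) → (Word n → Set) → Set
LexCode n X =
  (∀ x → X x → Σ (Order n) λ r → IsOrder r × LexMin r X x
       × (∀ r′ → IsOrder r′ → LexMin r′ X x → ∀ a → r′ a ≡ r a))
  × (∀ x p → X x → ProperPrefix p x →
       Σ (Word n) λ y → Σ (Word n) λ z → X y × X z × y ≢ z × Prefix p y × Prefix p z)

Edge : {n : ℕ} → Word n → Word n → Set
Edge {n} x y = ∃[ a ] Prefix x (a ∷ y)

next : {k : ℕ} → Fin (suc k) → Fin (suc k)
next {k} i = suc (toℕ i) mod suc k

Hamiltonian : {n : ℕ} → (Word n → Set) → Set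
Hamiltonian {n} X = Σ ℕ λ k → Σ (Fin (suc k) → Word n) λ c →
  Injective _≡_ _≡_ c
  × (∀ i → X (c i))
  × (∀ x → X x → ∃[ i ] c i ≡ x)
  × (∀ i → Edge (c i) (c (next i)))

{-# OPTIONS --safe #-}

-- Unroll a universal Lyndon word w cyclically into a periodic sequence W and let r i be the order
-- for which the rotation starting at position i is Lyndon; by counting, r reaches every order.
-- The point is that r i ranks the letters by their first occurrence in W from i on.  Suppose
-- instead that b comes before the letter c at i + ℓ in r i although b is not seen up to there.  Let
-- d be the immediate predecessor of c in r i and let j be the position whose order is r i with c
-- and d exchanged.  The rotations at i and j first differ at a letter d against c, beyond ℓ.  Drop
-- their first letters: the order of position i + 1 then has d before c, against the claim for i + 1
-- and a shorter prefix, in which c is seen and d is not.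
-- Consequently a factor u has total ◁_u iff it occurs once around the cycle, and MT(w) consists of
-- the shortest nonempty factors with a single occurrence, one for each starting position.  The
-- same description holds for the words of a Hamiltonian lex-code, each read along the cycle of
-- first letters, as the lex-code is prefix-free and its branching condition makes every proper
-- prefix occur again.
module Submission where

open import Defs
open import Data.Nat using (ℕ; zero; suc; _+_; _*_; _∸_; _/_; _%_; _≤_; _<_; _!; z≤n; s≤s; s≤s⁻¹; _≤?_; NonZero)
open import Data.Nat.Properties hiding (_≟_; suc-injective; 0≢1+n)
open import Data.Nat.DivMod
  using (_mod_; m≡m%n+[m/n]*n; m%n<n; m%n≤n; m%n%n≡m%n; [m+n]%n≡m%n; m<n⇒m%n≡m; m≤n⇒[n∸m]%m≡n%m; %-distribˡ-+)
open import Data.Fin using (Fin; zero; suc; toℕ; fromℕ<; _≟_; punchIn; punchOut; combine; remQuot)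
open import Data.Fin.Properties
  using (toℕ-injective; toℕ<n; toℕ-fromℕ<; any?; suc-injective; 0≢1+n; punchOut-injective;
         punchIn-injective; punchIn-punchOut; punchInᵢ≢i; combine-injective; combine-remQuot; injective⇒≤)
open import Data.Fin.Permutation.Components using (transpose; transpose-inverse)
open import Data.List using ([]; _∷_; _++_; length; lookup)
open import Data.List.Properties using (++-assoc; ++-identityʳ; ∷-injectiveˡ; ∷-injectiveʳ)
open import Data.List.Membership.Propositional using (_∈_; _∉_)
open import Data.List.Relation.Unary.Any using (here; there)
import Data.List.Relation.Binary.Lex.Strict as Strict
import Data.List.Relation.Binary.Pointwise as Pointwise
open import Data.Product using (Σ; ∃₂; ∃-syntax; _×_; _,_; proj₁; proj₂; uncurry)
open import Data.Sum using (_⊎_; inj₁; inj₂; [_,_]′)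
open import Data.Empty using (⊥; ⊥-elim)
open import Function using (_∘_; id; case_of_)
open import Function.Definitions using (Injective)
open import Function.Bundles using (_⇔_; mk⇔; Equivalence)
open import Relation.Binary using (tri<; tri≈; tri>)
open import Relation.Binary.PropositionalEquality
  using (_≡_; _≢_; refl; sym; trans; cong; cong₂; subst; subst₂; isEquivalence; module ≡-Reasoning)
open import Relation.Nullary using (¬_; yes; no; contradiction)
open import Relation.Nullary.Decidable using (_×-dec_; ¬?; dec-true)

-- Orders and Lehmer codes

-- A missed value could be punched out, leaving an injection into a smaller finite set. The sizes
-- are tied by an equation so that a word length can be matched with `n !`.
injective⇒surjective : ∀ {m n} → m ≡ n → {f : Fin m → Fin n} → Injective _≡_ _≡_ f → ∀ y → ∃[ x ] f x ≡ y
injective⇒surjective {suc n} refl {f} inj y with any? (λ x → f x ≟ y)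
... | yes hit = hit
... | no miss = contradiction (injective⇒≤ f-y-inj) (<-irrefl refl)
  where
  f-y-inj : Injective _≡_ _≡_ (λ x → punchOut {i = y} {j = f x} (λ eq → miss (x , sym eq)))
  f-y-inj {a} {b} eq = inj (punchOut-injective (λ e → miss (a , sym e)) (λ e → miss (b , sym e)) eq)

transpose-injective : ∀ {n} (i j : Fin n) → IsOrder (transpose i j)
transpose-injective i j {x} {y} eq = begin
  x                                 ≡⟨ transpose-inverse j i ⟨
  transpose j i (transpose i j x)   ≡⟨ cong (transpose j i) eq ⟩
  transpose j i (transpose i j y)   ≡⟨ transpose-inverse j i ⟩
  y                                 ∎
  where open ≡-Reasoning

-- The graph of the transposition as a view, so that `swap-reversed` can split on where both letters
-- go.
data Transposed {n : ℕ} (i j : Fin n) : Fin n → Fin n → Set where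
  left  : Transposed i j i j
  right : Transposed i j j i
  fixed : ∀ {k} → k ≢ i → k ≢ j → Transposed i j k k

transposed : ∀ {n} (i j k : Fin n) → Transposed i j k (transpose i j k)
transposed i j k with k ≟ i
... | yes refl = left
... | no k≢i with k ≟ j
...   | yes refl = right
...   | no k≢j = fixed k≢i k≢j

transpose-left : ∀ {n} (i j : Fin n) → transpose i j i ≡ j
transpose-left i j rewrite dec-true (i ≟ i) refl = refl

LtL-total : ∀ {n} {r : Order n} → IsOrder r → ∀ {a b} → a ≢ b → LtL r a b ⊎ LtL r b a
LtL-total {r = r} ord {a} {b} a≢b with <-cmp (toℕ (r a)) (toℕ (r b))
... | tri< lt _ _ = inj₁ lt
... | tri≈ _ eq _ = contradiction (ord (toℕ-injective eq)) a≢b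
... | tri> _ _ gt = inj₂ gt

LtL-resp : ∀ {n} {r s : Order n} → (∀ a → r a ≡ s a) → ∀ {a b} → LtL r a b → LtL s a b
LtL-resp r≗s {a} {b} = subst₂ (λ x y → toℕ x < toℕ y) (r≗s a) (r≗s b)

LtL⇒≢ : ∀ {n} (r : Order n) {a b} → LtL r a b → a ≢ b
LtL⇒≢ r lt refl = <-irrefl refl lt

Covers : ∀ {n} → Order n → Fin n → Fin n → Set
Covers r d c = suc (toℕ (r d)) ≡ toℕ (r c)

-- An injective rank function is onto, so the rank just below that of `c` belongs to some letter,
-- and no letter below `c` can rank higher.
predecessor : ∀ {n} {r : Order n} → IsOrder r → ∀ {b c} → LtL r b c →
  ∃[ d ] Covers r d c × toℕ (r b) ≤ toℕ (r d)
predecessor {n} {r} ord {b} {c} b<c with toℕ (r c) in eq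
... | suc k with injective⇒surjective refl ord (fromℕ< k<n)
  where
  k<n : k < n
  k<n = <-trans (≤-reflexive (sym eq)) (toℕ<n (r c))
...   | d , rd≡k = d , cong suc d≡k , ≤-trans (s≤s⁻¹ b<c) (≤-reflexive (sym d≡k))
  where
  d≡k : toℕ (r d) ≡ k
  d≡k = trans (cong toℕ rd≡k) (toℕ-fromℕ< _)

covers⇒LtL : ∀ {n} {r : Order n} {d c} → Covers r d c → LtL r d c
covers⇒LtL = ≤-reflexive

swap : ∀ {n} → Order n → Fin n → Fin n → Order n
swap r d c = r ∘ transpose d c

swap-isOrder : ∀ {n} {r : Order n} → IsOrder r → ∀ d c → IsOrder (swap r d c)
swap-isOrder ord d c = transpose-injective d c ∘ ord

-- The ranks of `d` and `c` are adjacent, so no third letter lies between them and exchanging the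
-- two alters no other comparison.
swap-reversed : ∀ {n} {r : Order n} {d c} → Covers r d c →
  ∀ {x y} → LtL r x y → LtL (swap r d c) y x → x ≡ d × y ≡ c
swap-reversed {r = r} {d} {c} cov {x} {y} x<y y<x
  with transpose d c x | transposed d c x | transpose d c y | transposed d c y
... | _ | left  | _ | left  = contradiction x<y (<-irrefl refl)
... | _ | left  | _ | right = refl , refl
... | _ | left  | _ | fixed _ _ =
  contradiction (<-≤-trans x<y (s≤s⁻¹ (≤-trans y<x (≤-reflexive (sym cov))))) (<-irrefl refl)
... | _ | right | _ | left  = contradiction x<y (<-asym (covers⇒LtL {r = r} cov))
... | _ | right | _ | right = contradiction x<y (<-irrefl refl)
... | _ | right | _ | fixed _ _ = contradiction (<-trans y<x (covers⇒LtL {r = r} cov)) (<-asym x<y)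
... | _ | fixed _ _ | _ | left  = contradiction (<-trans y<x x<y) (<-asym (covers⇒LtL {r = r} cov))
... | _ | fixed _ _ | _ | right =
  contradiction (<-≤-trans y<x (s≤s⁻¹ (≤-trans x<y (≤-reflexive (sym cov))))) (<-irrefl refl)
... | _ | fixed _ _ | _ | fixed _ _ = contradiction y<x (<-asym x<y)

tail : ∀ {n} (r : Order (suc n)) → IsOrder r → Order n
tail r ord i = punchOut {i = r zero} {j = r (suc i)} (0≢1+n ∘ ord)

tail-isOrder : ∀ {n} (r : Order (suc n)) (ord : IsOrder r) → IsOrder (tail r ord)
tail-isOrder r ord {x} {y} eq =
  suc-injective (ord (punchOut-injective (0≢1+n ∘ ord {zero} {suc x}) (0≢1+n ∘ ord {zero} {suc y}) eq))

-- Lehmer code: the rank of the first letter, then the code of the remaining order with the gap in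
-- the ranks closed. Orders are compared pointwise; the code moves counting to the finite set
-- `Fin (n !)`.
encode : ∀ n (r : Order n) → IsOrder r → Fin (n !)
encode zero r ord = zero
encode (suc n) r ord = combine (r zero) (encode n (tail r ord) (tail-isOrder r ord))

encode-injective : ∀ n {r s : Order n} (p : IsOrder r) (q : IsOrder s) →
  encode n r p ≡ encode n s q → ∀ a → r a ≡ s a
encode-injective (suc n) {r} {s} p q eq a with combine-injective (r zero) _ (s zero) _ eq
encode-injective (suc n) {r} {s} p q eq zero | heads , _ = heads
encode-injective (suc n) {r} {s} p q eq (suc a) | heads , tails = begin
  r (suc a)                        ≡⟨ punchIn-punchOut (0≢1+n ∘ p) ⟨
  punchIn (r zero) (tail r p a)    ≡⟨ cong₂ punchIn heads (encode-injective n (tail-isOrder r p) (tail-isOrder s q) tails a) ⟩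
  punchIn (s zero) (tail s q a)    ≡⟨ punchIn-punchOut (0≢1+n ∘ q) ⟩
  s (suc a)                        ∎
  where open ≡-Reasoning

-- Reads a number as Lehmer digits. Injectivity of `encode` bounds the number of orders by `n !`
-- from above, that of `decode` from below.
decode : ∀ n → Fin (n !) → Order n
decode (suc n) x with remQuot {suc n} (n !) x
... | h , t = λ { zero → h ; (suc i) → punchIn h (decode n t i) }

decode-isOrder : ∀ n (x : Fin (n !)) → IsOrder (decode n x)
decode-isOrder (suc n) x {zero} {zero} eq = refl
decode-isOrder (suc n) x {zero} {suc j} eq = contradiction (sym eq) (punchInᵢ≢i _ _)
decode-isOrder (suc n) x {suc i} {zero} eq = contradiction eq (punchInᵢ≢i _ _)
decode-isOrder (suc n) x {suc i} {suc j} eq =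
  cong suc (decode-isOrder n (proj₂ (remQuot {suc n} (n !) x)) (punchIn-injective (proj₁ (remQuot {suc n} (n !) x)) _ _ eq))

decode-injective : ∀ n {x y : Fin (n !)} → (∀ a → decode n x a ≡ decode n y a) → x ≡ y
decode-injective zero {zero} {zero} eq = refl
decode-injective (suc n) {x} {y} eq = begin
  x                                          ≡⟨ combine-remQuot {suc n} (n !) x ⟨
  uncurry combine (remQuot {suc n} (n !) x)  ≡⟨ cong₂ combine (eq zero) (decode-injective n tails) ⟩
  uncurry combine (remQuot {suc n} (n !) y)  ≡⟨ combine-remQuot {suc n} (n !) y ⟩
  y                                          ∎
  where
  open ≡-Reasoning
  tails : ∀ a → decode n (proj₂ (remQuot {suc n} (n !) x)) a ≡ decode n (proj₂ (remQuot {suc n} (n !) y)) a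
  tails a = punchIn-injective (proj₁ (remQuot {suc n} (n !) x)) _ _
    (trans (eq (suc a)) (cong (λ h → punchIn h (decode n (proj₂ (remQuot {suc n} (n !) y)) a)) (sym (eq zero))))

-- Ranking letters by first occurrence

module _ {n : ℕ} (W : ℕ → Fin n) where

  Agree : ℕ → ℕ → ℕ → Set
  Agree i j m = ∀ k → k < m → W (i + k) ≡ W (j + k)

  Unseen : ℕ → ℕ → Fin n → Set
  Unseen i ℓ b = ∀ q → q < ℓ → W (i + q) ≢ b

  infix 4 _~_
  -- Positions are identified when they start the same infinite suffix; in `Cycle` this turns out to
  -- be congruence modulo the period.
  _~_ : ℕ → ℕ → Set
  i ~ j = ∀ k → W (i + k) ≡ W (j + k)

  -- Lexicographic order on infinite suffixes: none is a proper prefix of another, so only a first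
  -- difference decides.
  Less : Order n → ℕ → ℕ → Set
  Less r i j = ∃[ m ] Agree i j m × LtL r (W (i + m)) (W (j + m))

first-difference : ∀ {n} {W : ℕ → Fin n} {r i j m} → Agree W i j m → W (i + m) ≢ W (j + m) →
  Less W r i j → LtL r (W (i + m)) (W (j + m))
first-difference {r = r} {m = m} agr diff (m′ , agr′ , lt) with <-cmp m m′
... | tri< m<m′ _ _ = contradiction (agr′ m m<m′) diff
... | tri≈ _ refl _ = lt
... | tri> _ _ m′<m = contradiction (agr m′ m′<m) (LtL⇒≢ r lt)

shift-~ : ∀ {n} (W : ℕ → Fin n) {i j} → W i ≡ W j → _~_ W (suc i) (suc j) → _~_ W i j
shift-~ W {i} {j} heads tails zero = subst₂ (λ x y → W x ≡ W y) (sym (+-identityʳ i)) (sym (+-identityʳ j)) heads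
shift-~ W {i} {j} heads tails (suc k) = subst₂ (λ x y → W x ≡ W y) (sym (+-suc i k)) (sym (+-suc j k)) (tails k)

-- The hypotheses are the common ground of both directions: each suffix is least in its own order,
-- equal suffixes have equal orders, and every order occurs at some position.
module FirstOccurrence {n : ℕ} (W : ℕ → Fin n) (r : ℕ → Order n)
  (ord : ∀ i → IsOrder (r i))
  (least : ∀ i j → (_~_ W i j) ⊎ Less W (r i) i j)
  (resp : ∀ {i j} → _~_ W i j → ∀ a → r i a ≡ r j a)
  (onto : ∀ s → IsOrder s → ∃[ i ] (∀ a → r i a ≡ s a))
  where

  least-at : ∀ {i j m} → Agree W i j m → W (i + m) ≢ W (j + m) → LtL (r i) (W (i + m)) (W (j + m))
  least-at {i} {j} {m} agr diff with least i j
  ... | inj₁ same = contradiction (same m) diff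
  ... | inj₂ lt = first-difference {W = W} {r = r i} agr diff lt

  -- `j` is the position whose order is `r i` with the two letters exchanged. Each suffix is the
  -- smaller one in its own order, so the two orders disagree on the letters at the first
  -- difference; only the exchanged pair allows this.
  exchange : ∀ {i d c} → Covers (r i) d c →
    ∃₂ λ j m → Agree W i j m × W (i + m) ≡ d × W (j + m) ≡ c
  exchange {i} {d} {c} cov with onto (swap (r i) d c) (swap-isOrder (ord i) d c)
  ... | j , rj≗ with least i j
  -- Equal suffixes have equal orders, yet the exchange alters the rank of `d`. Taken at `id`, `LtL`
  -- compares the ranks themselves.
  ...   | inj₁ same = contradiction rc≡rd (λ eq → LtL⇒≢ id (covers⇒LtL {r = r i} cov) (sym eq))
    where
    rc≡rd : r i c ≡ r i d
    rc≡rd = sym (trans (resp same d) (trans (rj≗ d) (cong (r i) (transpose-left d c))))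
  ...   | inj₂ (m , agr , lt) = j , m , agr ,
    swap-reversed {r = r i} cov lt (LtL-resp {r = r j} rj≗
      (least-at (λ k k<m → sym (agr k k<m)) (LtL⇒≢ (r i) lt ∘ sym)))

  Ranked : ℕ → ℕ → Set
  Ranked i ℓ = ∀ {p b} → p < ℓ → Unseen W i (suc p) b → LtL (r i) (W (i + p)) b

  -- The induction hypothesis covers all positions because it serves twice: at `i`, to show that `d`
  -- is unseen, and at `suc i`, for the contradiction.
  ranked-step : ∀ ℓ → (∀ i → Ranked i ℓ) → ∀ i {b} → Unseen W i (suc ℓ) b → LtL (r i) (W (i + ℓ)) b
  ranked-step ℓ IH i {b} unseen with LtL-total {r = r i} (ord i) (unseen ℓ ≤-refl)
  ... | inj₁ c<b = c<b
  ... | inj₂ b<c with predecessor (ord i) b<c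
  ...   | d , cov , b≤d with exchange {i} cov
  ...     | j , m , agr , i+m≡d , j+m≡c = ⊥-elim (absurd ℓ m refl refl)
    where
    c : Fin n
    c = W (i + ℓ)
    d<c : LtL (r i) d c
    d<c = covers⇒LtL {r = r i} cov
    -- Every letter before offset `ℓ` is below `b` in `r i`, whereas `d` is not; at offset `ℓ`
    -- stands `c`, which differs from `d`.
    d-unseen : Unseen W i (suc ℓ) d
    d-unseen q q≤ℓ q≡d with m≤n⇒m<n∨m≡n (s≤s⁻¹ q≤ℓ)
    ... | inj₂ refl = LtL⇒≢ (r i) d<c (sym q≡d)
    ... | inj₁ q<ℓ = <-irrefl refl (<-≤-trans
      (subst (λ x → LtL (r i) x b) q≡d (IH i q<ℓ (λ q′ q′≤q → unseen q′ (<-trans q′≤q (s≤s q<ℓ)))))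
      b≤d)
    ℓ<m : ℓ < m
    ℓ<m with suc ℓ ≤? m
    ... | yes lt = lt
    ... | no ¬lt = contradiction i+m≡d (d-unseen m (s≤s (≮⇒≥ ¬lt)))
    absurd : ∀ ℓ′ m′ → ℓ ≡ ℓ′ → m ≡ m′ → ⊥
    -- With `ℓ` zero the suffix at `i` starts with `c` and the one at `i + m` with `d`, so leastness
    -- at `i` already puts `c` before `d`.
    absurd zero _ refl refl = <-asym d<c (subst (LtL (r i) c) i+m+0≡d
      (least-at {i} {i + m} {0} (λ _ ()) (λ eq → LtL⇒≢ (r i) d<c (sym (trans eq i+m+0≡d)))))
      where
      i+m+0≡d : W (i + m + 0) ≡ d
      i+m+0≡d = trans (cong W (+-identityʳ (i + m))) i+m≡d
    absurd (suc ℓ′) zero refl refl = case ℓ<m of λ ()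
    absurd (suc ℓ′) (suc m′) refl refl = <-asym d<c′ c<d′
      where
      unshift : ∀ x k → W (suc x + k) ≡ W (x + suc k)
      unshift x k = cong W (sym (+-suc x k))
      d≡ : W (suc i + m′) ≡ d
      d≡ = trans (unshift i m′) i+m≡d
      c≡ : W (suc j + m′) ≡ c
      c≡ = trans (unshift j m′) j+m≡c
      d<c′ : LtL (r (suc i)) d c
      d<c′ = subst₂ (LtL (r (suc i))) d≡ c≡ (least-at
        (λ k k<m′ → trans (unshift i k) (trans (agr (suc k) (s≤s k<m′)) (sym (unshift j k))))
        (λ eq → LtL⇒≢ (r i) d<c (trans (sym d≡) (trans eq c≡))))
      c<d′ : LtL (r (suc i)) c d
      c<d′ = subst (λ x → LtL (r (suc i)) x d) (unshift i ℓ′) (IH (suc i) ≤-refl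
        (λ q q≤ℓ′ eq → d-unseen (suc q) (s≤s q≤ℓ′) (trans (sym (unshift i q)) eq)))

  ranked : ∀ ℓ i → Ranked i ℓ
  ranked (suc ℓ) i p≤ℓ unseen with m≤n⇒m<n∨m≡n (s≤s⁻¹ p≤ℓ)
  ... | inj₁ p<ℓ = ranked ℓ i p<ℓ unseen
  ... | inj₂ refl = ranked-step ℓ (ranked ℓ) i unseen

  abstract
    -- Exchanging the larger of the two letters with its predecessor `d` leads to another position,
    -- and the suffixes part at an occurrence of `d`. Letters of the window rank below the smaller
    -- missing letter and `d` does not, so they part only after the window.
    missing-pair⇒repeated : ∀ {i ℓ a b} → a ≢ b → Unseen W i ℓ a → Unseen W i ℓ b →
      ∃[ j ] Agree W j i ℓ × ¬ (_~_ W i j)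
    missing-pair⇒repeated {i} {ℓ} {a} {b} a≢b a∉ b∉ =
      [ go a∉ , go b∉ ]′ (LtL-total {r = r i} (ord i) a≢b)
      where
      go : ∀ {x y} → Unseen W i ℓ x → LtL (r i) x y → ∃[ j ] Agree W j i ℓ × ¬ (_~_ W i j)
      go {x} {y} x∉ x<y with predecessor (ord i) x<y
      ... | d , cov , x≤d with exchange {i} cov
      ...   | j , m , agr , i+m≡d , j+m≡y = j , (λ k k<ℓ → sym (agr k (<-≤-trans k<ℓ ℓ≤m))) ,
              λ same → LtL⇒≢ (r i) (covers⇒LtL {r = r i} cov) (trans (sym i+m≡d) (trans (same m) j+m≡y))
        where
        ℓ≤m : ℓ ≤ m
        ℓ≤m with ℓ ≤? m
        ... | yes le = le
        ... | no ¬le = contradiction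
          (subst (λ z → LtL (r i) z x) i+m≡d (ranked ℓ i (≰⇒> ¬le) (λ q q≤m → x∉ q (≤-trans q≤m (≰⇒> ¬le)))))
          (λ d<x → <-irrefl refl (<-≤-trans d<x x≤d))

-- Windows of a sequence

length-positive : ∀ {n} {u : Word n} → u ≢ [] → 1 ≤ length u
length-positive {u = []} u≢[] = contradiction refl u≢[]
length-positive {u = _ ∷ _} _ = s≤s z≤n

module _ {n : ℕ} (W : ℕ → Fin n) where
  window : ℕ → ℕ → Word n
  window i zero = []
  window i (suc ℓ) = W i ∷ window (suc i) ℓ

module _ {n : ℕ} {W : ℕ → Fin n} where
  open import Data.List.Membership.DecPropositional (_≟_ {n}) using (_∈?_)

  window≢[] : ∀ {i ℓ} → 1 ≤ ℓ → window W i ℓ ≢ []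
  window≢[] (s≤s _) ()

  length-window : ∀ i ℓ → length (window W i ℓ) ≡ ℓ
  length-window i zero = refl
  length-window i (suc ℓ) = cong suc (length-window (suc i) ℓ)

  window-lengths : ∀ {i j ℓ ℓ′} → window W i ℓ ≡ window W j ℓ′ → ℓ ≡ ℓ′
  window-lengths {i} {j} {ℓ} {ℓ′} eq = trans (sym (length-window i ℓ)) (trans (cong length eq) (length-window j ℓ′))

  window-++ : ∀ i a b → window W i (a + b) ≡ window W i a ++ window W (i + a) b
  window-++ i zero b = cong (λ x → window W x b) (sym (+-identityʳ i))
  window-++ i (suc a) b = cong (W i ∷_) (trans (window-++ (suc i) a b)
    (cong (λ x → window W (suc i) a ++ window W x b) (sym (+-suc i a))))

  window-split : ∀ i {a ℓ} → a ≤ ℓ → window W i ℓ ≡ window W i a ++ window W (i + a) (ℓ ∸ a)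
  window-split i {a} {ℓ} a≤ℓ = trans (cong (window W i) (sym (m+[n∸m]≡n a≤ℓ))) (window-++ i a (ℓ ∸ a))

  agree⇒window : ∀ {i j} ℓ → Agree W i j ℓ → window W i ℓ ≡ window W j ℓ
  agree⇒window zero agr = refl
  agree⇒window {i} {j} (suc ℓ) agr = cong₂ _∷_
    (subst₂ (λ x y → W x ≡ W y) (+-identityʳ i) (+-identityʳ j) (agr 0 (s≤s z≤n)))
    (agree⇒window ℓ (λ k k<ℓ → subst₂ (λ x y → W x ≡ W y) (+-suc i k) (+-suc j k) (agr (suc k) (s≤s k<ℓ))))

  ~⇒window : ∀ {i j} → _~_ W i j → ∀ ℓ → window W i ℓ ≡ window W j ℓ
  ~⇒window same ℓ = agree⇒window ℓ (λ k _ → same k)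

  window⇒agree : ∀ {i j} ℓ → window W i ℓ ≡ window W j ℓ → Agree W i j ℓ
  window⇒agree {i} {j} (suc ℓ) eq zero _ =
    subst₂ (λ x y → W x ≡ W y) (sym (+-identityʳ i)) (sym (+-identityʳ j)) (∷-injectiveˡ eq)
  window⇒agree {i} {j} (suc ℓ) eq (suc k) k<ℓ =
    subst₂ (λ x y → W x ≡ W y) (sym (+-suc i k)) (sym (+-suc j k))
      (window⇒agree ℓ (∷-injectiveʳ eq) k (s≤s⁻¹ k<ℓ))

  window-shorter : ∀ {i j ℓ ℓ′} → ℓ′ ≤ ℓ → window W i ℓ ≡ window W j ℓ → window W i ℓ′ ≡ window W j ℓ′
  window-shorter {ℓ = ℓ} {ℓ′} le eq = agree⇒window ℓ′ (λ k k<ℓ′ → window⇒agree ℓ eq k (<-≤-trans k<ℓ′ le))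

  -- Turns factorisations of a window into positions and lengths, in which all arguments about
  -- factors are carried out.
  ++≡window : ∀ u {v i ℓ} → u ++ v ≡ window W i ℓ →
    u ≡ window W i (length u) × v ≡ window W (i + length u) (length v) × length u + length v ≡ ℓ
  ++≡window [] {v} {i} {ℓ} eq =
    refl , trans eq (cong₂ (window W) (sym (+-identityʳ i)) (sym lengths)) , lengths
    where
    lengths : length v ≡ ℓ
    lengths = trans (cong length eq) (length-window i ℓ)
  ++≡window (a ∷ u) {v} {i} {suc ℓ} eq with ++≡window u {v} {suc i} {ℓ} (∷-injectiveʳ eq)
  ... | u≡ , v≡ , lengths = cong₂ _∷_ (∷-injectiveˡ eq) u≡ ,
    trans v≡ (cong (λ x → window W x (length v)) (sym (+-suc i (length u)))) , cong suc lengths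

  prefix-window : ∀ i {ℓ ℓ′} → ℓ ≤ ℓ′ → Prefix (window W i ℓ) (window W i ℓ′)
  prefix-window i le = _ , sym (window-split i le)

  ∈-window⁻ : ∀ {b} i ℓ → b ∈ window W i ℓ → ∃[ q ] q < ℓ × W (i + q) ≡ b
  ∈-window⁻ i (suc ℓ) (here refl) = 0 , s≤s z≤n , cong W (+-identityʳ i)
  ∈-window⁻ i (suc ℓ) (there b∈) with ∈-window⁻ (suc i) ℓ b∈
  ... | q , q<ℓ , eq = suc q , s≤s q<ℓ , trans (cong W (+-suc i q)) eq

  ∈-window⁺ : ∀ i {ℓ q} → q < ℓ → W (i + q) ∈ window W i ℓ
  ∈-window⁺ i {suc ℓ} {zero} _ = here (cong W (+-identityʳ i))
  ∈-window⁺ i {suc ℓ} {suc q} q<ℓ = there (subst (λ x → W x ∈ window W (suc i) ℓ) (sym (+-suc i q)) (∈-window⁺ (suc i) (s≤s⁻¹ q<ℓ)))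

  ∉-window⇒unseen : ∀ {b i ℓ} → b ∉ window W i ℓ → Unseen W i ℓ b
  ∉-window⇒unseen {i = i} b∉ q q<ℓ refl = b∉ (∈-window⁺ i q<ℓ)

  firstOcc-window : ∀ {a} i ℓ → a ∈ window W i ℓ →
    firstOcc a (window W i ℓ) < ℓ × W (i + firstOcc a (window W i ℓ)) ≡ a
  firstOcc-window {a} i (suc ℓ) a∈ with a ≟ W i | a∈
  ... | yes a≡ | _ = s≤s z≤n , trans (cong W (+-identityʳ i)) (sym a≡)
  ... | no a≢ | here a≡ = contradiction a≡ a≢
  ... | no a≢ | there a∈′ with firstOcc-window (suc i) ℓ a∈′
  ...   | lt , eq = s≤s lt , trans (cong W (+-suc i _)) eq

  firstOcc-≤ : ∀ {b} i ℓ q → q < ℓ → W (i + q) ≡ b → firstOcc b (window W i ℓ) ≤ q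
  firstOcc-≤ {b} i (suc ℓ) q q<ℓ eq with b ≟ W i
  ... | yes _ = z≤n
  firstOcc-≤ i (suc ℓ) zero q<ℓ eq | no b≢ = contradiction (trans (sym eq) (cong W (+-identityʳ i))) b≢
  firstOcc-≤ i (suc ℓ) (suc q) q<ℓ eq | no b≢ =
    s≤s (firstOcc-≤ (suc i) ℓ q (s≤s⁻¹ q<ℓ) (trans (cong W (sym (+-suc i q))) eq))

  -- Both alternatives of `Tri`, absence of `b` or a later first occurrence, say that `b` is unseen
  -- up to the first `a`.
  tri⇒position : ∀ {i ℓ a b} → Tri (window W i ℓ) a b →
    ∃[ p ] p < ℓ × W (i + p) ≡ a × Unseen W i (suc p) b
  tri⇒position {i} {ℓ} {a} {b} (a∈ , later) with firstOcc-window i ℓ a∈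
  ... | p<ℓ , eq = _ , p<ℓ , eq , unseen later
    where
    unseen : (b ∉ window W i ℓ ⊎ firstOcc a (window W i ℓ) < firstOcc b (window W i ℓ)) →
      Unseen W i (suc (firstOcc a (window W i ℓ))) b
    unseen (inj₁ b∉) q q≤p = ∉-window⇒unseen b∉ q (<-≤-trans q≤p p<ℓ)
    unseen (inj₂ fa<fb) q q≤p eq′ =
      <-irrefl refl (<-≤-trans fa<fb (≤-trans (firstOcc-≤ i ℓ q (<-≤-trans q≤p p<ℓ) eq′) (s≤s⁻¹ q≤p)))

  -- Irreflexivity and transitivity hold for every word. Distinct letters are incomparable only if
  -- both are missing, since letters with the same first position coincide.
  tri-total : ∀ i ℓ → (∀ a b → a ≢ b → a ∉ window W i ℓ → b ∈ window W i ℓ) → IsStrictTotal (Tri (window W i ℓ))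
  tri-total i ℓ one-missing = irreflexive , transitive , total
    where
    u = window W i ℓ
    irreflexive : ∀ a → ¬ Tri u a a
    irreflexive a (a∈ , inj₁ a∉) = a∉ a∈
    irreflexive a (a∈ , inj₂ lt) = <-irrefl refl lt
    transitive : ∀ a b c → Tri u a b → Tri u b c → Tri u a c
    transitive a b c (a∈ , inj₁ b∉) (b∈ , _) = contradiction b∈ b∉
    transitive a b c (a∈ , inj₂ a<b) (b∈ , inj₁ c∉) = a∈ , inj₁ c∉
    transitive a b c (a∈ , inj₂ a<b) (b∈ , inj₂ b<c) = a∈ , inj₂ (<-trans a<b b<c)
    total : ∀ a b → a ≢ b → Tri u a b ⊎ Tri u b a
    total a b a≢b with a ∈? u | b ∈? u
    ... | no a∉ | _ = inj₂ (one-missing a b a≢b a∉ , inj₁ a∉)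
    ... | yes a∈ | no b∉ = inj₁ (a∈ , inj₁ b∉)
    ... | yes a∈ | yes b∈ with <-cmp (firstOcc a u) (firstOcc b u)
    ...   | tri< lt _ _ = inj₁ (a∈ , inj₂ lt)
    ...   | tri> _ _ gt = inj₂ (b∈ , inj₂ gt)
    ...   | tri≈ _ eq _ = contradiction
      (trans (sym (proj₂ (firstOcc-window i ℓ a∈)))
        (trans (cong (λ x → W (i + x)) eq) (proj₂ (firstOcc-window i ℓ b∈)))) a≢b

  tri-total? : ∀ i ℓ → IsStrictTotal (Tri (window W i ℓ)) ⊎
    ∃₂ λ a b → a ≢ b × a ∉ window W i ℓ × b ∉ window W i ℓ
  tri-total? i ℓ with any? (λ a → any? (λ b → ¬? (a ≟ b) ×-dec (¬? (a ∈? window W i ℓ) ×-dec ¬? (b ∈? window W i ℓ))))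
  ... | yes missing = inj₂ missing
  ... | no ¬missing = inj₁ (tri-total i ℓ λ a b a≢b a∉ → decide a b a≢b a∉)
    where
    decide : ∀ a b → a ≢ b → a ∉ window W i ℓ → b ∈ window W i ℓ
    decide a b a≢b a∉ with b ∈? window W i ℓ
    ... | yes b∈ = b∈
    ... | no b∉ = contradiction (a , b , a≢b , a∉ , b∉) ¬missing

  less⇒lex : ∀ {r i j ℓ ℓ′} ((m , _) : Less W r i j) → m < ℓ → m < ℓ′ → Lex r (window W i ℓ) (window W j ℓ′)
  less⇒lex {i = i} {j} {ℓ} {ℓ′} (m , agr , lt) m<ℓ m<ℓ′ =
    inj₂ (window W i m , W (i + m) , W (j + m) , _ , _ , cut i m<ℓ ,
      trans (cut j m<ℓ′) (cong (_++ (W (j + m) ∷ window W (suc (j + m)) (ℓ′ ∸ suc m))) (sym (agree⇒window m agr))) , lt)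
    where
    cut : ∀ x {l} → m < l → window W x l ≡ window W x m ++ (W (x + m) ∷ window W (suc (x + m)) (l ∸ suc m))
    cut x {l} m<l = trans (window-split x (<⇒≤ m<l)) (cong (λ y → window W x m ++ window W (x + m) y) (+-∸-assoc 1 m<l))

  -- The proper-prefix alternative remains here; it is later excluded by equal lengths for rotations
  -- and by prefix-freeness for code words.
  lex⇒less : ∀ {r i j ℓ ℓ′} → Lex r (window W i ℓ) (window W j ℓ′) →
    (ℓ < ℓ′ × window W i ℓ ≡ window W j ℓ) ⊎ Less W r i j
  lex⇒less {i = i} {j} {ℓ} {ℓ′} (inj₁ (s , s≢[] , eq)) with ++≡window (window W i ℓ) eq
  ... | u≡ , _ , lengths rewrite length-window i ℓ = inj₁ (ℓ<ℓ′ s s≢[] lengths , u≡)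
    where
    ℓ<ℓ′ : ∀ s → s ≢ [] → ℓ + length s ≡ ℓ′ → ℓ < ℓ′
    ℓ<ℓ′ [] s≢[] _ = contradiction refl s≢[]
    ℓ<ℓ′ (_ ∷ s) _ eq = subst (ℓ <_) eq (m<m+n ℓ (s≤s z≤n))
  lex⇒less {r} {i} {j} {ℓ} {ℓ′} (inj₂ (z , a , b , u′ , v′ , u≡ , v≡ , a<b))
    with ++≡window z (sym u≡) | ++≡window z (sym v≡)
  ... | z≡ , a∷≡ , _ | z≡′ , b∷≡ , _ = inj₂ (length z , window⇒agree (length z) (trans (sym z≡) z≡′) ,
    subst₂ (LtL r) (∷-injectiveˡ a∷≡) (∷-injectiveˡ b∷≡) a<b)

-- Periodic sequences, rotations and cyclic factors

module Periodic {n K : ℕ} (W : ℕ → Fin n) (periodic : ∀ k → W (k + suc K) ≡ W k) where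
  N : ℕ
  N = suc K

  W-+* : ∀ k m → W (k + m * N) ≡ W k
  W-+* k zero = cong W (+-identityʳ k)
  W-+* k (suc m) = trans (cong W (trans (cong (k +_) (+-comm N (m * N))) (sym (+-assoc k (m * N) N))))
    (trans (periodic (k + m * N)) (W-+* k m))

  %-~ : ∀ i → _~_ W (i % N) i
  %-~ i k = sym (begin
    W (i + k)                        ≡⟨ cong (λ x → W (x + k)) (m≡m%n+[m/n]*n i N) ⟩
    W (i % N + i / N * N + k)        ≡⟨ cong W (+-assoc (i % N) _ k) ⟩
    W (i % N + (i / N * N + k))      ≡⟨ cong (λ x → W (i % N + x)) (+-comm (i / N * N) k) ⟩
    W (i % N + (k + i / N * N))      ≡⟨ cong W (+-assoc (i % N) k _) ⟨
    W (i % N + k + i / N * N)        ≡⟨ W-+* (i % N + k) (i / N) ⟩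
    W (i % N + k)                    ∎)
    where open ≡-Reasoning

  %-≡⇒~ : ∀ {i j} → i % N ≡ j % N → _~_ W i j
  %-≡⇒~ {i} {j} eq k = trans (sym (%-~ i k)) (trans (cong (λ x → W (x + k)) eq) (%-~ j k))

  +N-~ : ∀ i → _~_ W (i + N) i
  +N-~ i = %-≡⇒~ ([m+n]%n≡m%n i N)

  agree-N⇒~ : ∀ {i j} → Agree W i j N → _~_ W i j
  agree-N⇒~ {i} {j} agr k = trans (reduce i) (trans (agr (k % N) (m%n<n k N)) (sym (reduce j)))
    where
    reduce : ∀ x → W (x + k) ≡ W (x + k % N)
    reduce x = trans (cong W (+-comm x k)) (trans (sym (%-~ k x)) (cong W (+-comm (k % N) x)))

  -- The letters of `u` recur one period later, directly after `v`.
  rotate : ∀ i u {v} → u ++ v ≡ window W i N → v ++ u ≡ window W (i + length u) N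
  rotate i u {v} eq with ++≡window u {v} {i} eq
  ... | u≡ , v≡ , lengths = begin
    v ++ u ≡⟨ cong₂ _++_ v≡ (trans u≡ (sym (trans (cong (λ x → window W x (length u)) i+) (~⇒window (+N-~ i) (length u))))) ⟩
    window W (i + length u) (length v) ++ window W (i + length u + length v) (length u)
           ≡⟨ window-++ (i + length u) (length v) (length u) ⟨
    window W (i + length u) (length v + length u)
           ≡⟨ cong (window W (i + length u)) (trans (+-comm (length v) (length u)) lengths) ⟩
    window W (i + length u) N ∎
    where
    open ≡-Reasoning
    i+ : i + length u + length v ≡ i + N
    i+ = trans (+-assoc i _ _) (cong (i +_) lengths)

  window-rotated : ∀ i {s} → s ≤ N →
    window W i N ≡ window W i s ++ window W (i + s) (N ∸ s) ×
    window W (i + s) N ≡ window W (i + s) (N ∸ s) ++ window W i s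
  window-rotated i {s} s≤N = window-split i s≤N , sym (trans
    (rotate i (window W i s) (sym (window-split i s≤N)))
    (cong (λ x → window W (i + x) N) (length-window i s)))

  cyclicFactor⇒window : ∀ {u} → CyclicFactor (window W 0 N) u →
    ∃₂ λ i ℓ → 1 ≤ ℓ × u ≡ window W i ℓ
  cyclicFactor⇒window {u} (u≢[] , _ , p , s , eq)
    with ++≡window p {u ++ s} {0} {N + N} (trans eq (sym (trans (window-++ 0 N N) (cong (window W 0 N ++_) (~⇒window (+N-~ 0) N)))))
  ... | _ , us≡ , _ with ++≡window u {s} us≡
  ...   | u≡ , _ = length p , length u , length-positive u≢[] , u≡

  window⇒cyclicFactor : ∀ i {ℓ} → 1 ≤ ℓ → ℓ ≤ N → CyclicFactor (window W 0 N) (window W i ℓ)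
  window⇒cyclicFactor i {suc ℓ} _ ℓ≤N = (λ ()) , subst₂ _≤_ (sym (length-window i (suc ℓ))) (sym (length-window 0 N)) ℓ≤N ,
    window W 0 t , window W (t + suc ℓ) (N + N ∸ (t + suc ℓ)) , (begin
      window W 0 t ++ window W i (suc ℓ) ++ rest
        ≡⟨ cong (λ x → window W 0 t ++ x ++ rest) (~⇒window (%-~ i) (suc ℓ)) ⟨
      window W 0 t ++ window W t (suc ℓ) ++ rest
        ≡⟨ ++-assoc (window W 0 t) _ _ ⟨
      (window W 0 t ++ window W t (suc ℓ)) ++ rest
        ≡⟨ cong (_++ rest) (window-++ 0 t (suc ℓ)) ⟨
      window W 0 (t + suc ℓ) ++ rest
        ≡⟨ window-split 0 (+-mono-≤ (m%n≤n i N) ℓ≤N) ⟨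
      window W 0 (N + N)
        ≡⟨ window-++ 0 N N ⟩
      window W 0 N ++ window W N N
        ≡⟨ cong (window W 0 N ++_) (~⇒window (+N-~ 0) N) ⟩
      window W 0 N ++ window W 0 N ∎)
    where
    open ≡-Reasoning
    -- Reducing the start modulo the period makes the window end within the first two periods.
    t = i % N
    rest = window W (t + suc ℓ) (N + N ∸ (t + suc ℓ))

-- Lexicographic order

-- The inductive form of `Lex`, from which transitivity and irreflexivity are transported.
StrictLex : ∀ {n} → Order n → Word n → Word n → Set
StrictLex r = Strict.Lex-< _≡_ (LtL r)

lex⇒strict : ∀ {n} {r : Order n} {u v} → Lex r u v → StrictLex r u v
lex⇒strict {u = u} (inj₁ (s , s≢[] , refl)) = prefix u s s≢[]
  where
  prefix : ∀ {n} {r : Order n} u s → s ≢ [] → StrictLex r u (u ++ s)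
  prefix [] [] s≢[] = contradiction refl s≢[]
  prefix [] (_ ∷ s) _ = Strict.halt
  prefix (a ∷ u) s s≢[] = Strict.next refl (prefix u s s≢[])
lex⇒strict (inj₂ (z , a , b , u′ , v′ , refl , refl , a<b)) = letters z a<b
  where
  letters : ∀ {n} {r : Order n} {a b u′ v′} z → LtL r a b → StrictLex r (z ++ a ∷ u′) (z ++ b ∷ v′)
  letters [] a<b = Strict.this a<b
  letters (_ ∷ z) a<b = Strict.next refl (letters z a<b)

strict⇒lex : ∀ {n} {r : Order n} {u v} → StrictLex r u v → Lex r u v
strict⇒lex (Strict.base ())
strict⇒lex Strict.halt = inj₁ (_ , (λ ()) , refl)
strict⇒lex (Strict.this a<b) = inj₂ ([] , _ , _ , _ , _ , refl , refl , a<b)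
strict⇒lex {u = a ∷ _} (Strict.next refl u<v) with strict⇒lex u<v
... | inj₁ (s , s≢[] , eq) = inj₁ (s , s≢[] , cong (a ∷_) eq)
... | inj₂ (z , x , y , u′ , v′ , eq , eq′ , x<y) =
  inj₂ (a ∷ z , x , y , u′ , v′ , cong (a ∷_) eq , cong (a ∷_) eq′ , x<y)

lex-trans : ∀ {n} {r : Order n} {u v w} → Lex r u v → Lex r v w → Lex r u w
lex-trans {r = r} u<v v<w = strict⇒lex (Strict.<-transitive isEquivalence
  ((λ { refl → id }) , (λ { refl → id })) <-trans (lex⇒strict u<v) (lex⇒strict v<w))

lex-irrefl : ∀ {n} {r : Order n} {u} → ¬ Lex r u u
lex-irrefl {r = r} {u} u<u = Strict.<-irreflexive {_≈_ = _≡_} {_≺_ = LtL r} (λ { refl → <-irrefl refl }) (Pointwise.refl refl) (lex⇒strict u<u)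

lex-asym : ∀ {n} {r : Order n} {u v} → Lex r u v → ¬ Lex r v u
lex-asym u<v v<u = lex-irrefl (lex-trans u<v v<u)

lex-total : ∀ {n} {r : Order n} → IsOrder r → ∀ u v → u ≡ v ⊎ Lex r u v ⊎ Lex r v u
lex-total ord [] [] = inj₁ refl
lex-total ord [] (_ ∷ v) = inj₂ (inj₁ (strict⇒lex Strict.halt))
lex-total ord (_ ∷ u) [] = inj₂ (inj₂ (strict⇒lex Strict.halt))
lex-total {r = r} ord (a ∷ u) (b ∷ v) with a ≟ b
... | no a≢b = inj₂ ([ inj₁ ∘ strict⇒lex ∘ Strict.this , inj₂ ∘ strict⇒lex ∘ Strict.this ]′ (LtL-total {r = r} ord a≢b))
... | yes refl with lex-total {r = r} ord u v
...   | inj₁ refl = inj₁ refl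
...   | inj₂ (inj₁ lt) = inj₂ (inj₁ (strict⇒lex (Strict.next refl (lex⇒strict lt))))
...   | inj₂ (inj₂ gt) = inj₂ (inj₂ (strict⇒lex (Strict.next refl (lex⇒strict gt))))

lex-resp : ∀ {n} {r s : Order n} → (∀ a → r a ≡ s a) → ∀ {u v} → Lex r u v → Lex s u v
lex-resp r≗s (inj₁ prefix) = inj₁ prefix
lex-resp {r = r} {s} r≗s (inj₂ (z , a , b , u′ , v′ , eq , eq′ , a<b)) =
  inj₂ (z , a , b , u′ , v′ , eq , eq′ , LtL-resp {r = r} {s} r≗s a<b)

lexMinimum : ∀ {n k} {r : Order n} → IsOrder r → (f : Fin (suc k) → Word n) →
  ∃[ i ] (∀ j → f j ≡ f i ⊎ Lex r (f i) (f j))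
lexMinimum {k = zero} ord f = zero , λ { zero → inj₁ refl }
lexMinimum {k = suc k} {r} ord f with lexMinimum {r = r} ord (f ∘ suc)
... | i , min with lex-total {r = r} ord (f zero) (f (suc i))
...   | inj₁ eq = suc i , λ { zero → inj₁ eq ; (suc j) → min j }
...   | inj₂ (inj₂ gt) = suc i , λ { zero → inj₂ gt ; (suc j) → min j }
...   | inj₂ (inj₁ lt) = zero , λ
  { zero → inj₁ refl
  ; (suc j) → inj₂ ([ (λ eq → subst (Lex r (f zero)) (sym eq) lt) , lex-trans {r = r} lt ]′ (min j)) }

-- Positions modulo the period

toℕ-mod : ∀ i N .{{_ : NonZero N}} → toℕ (i mod N) ≡ i % N
toℕ-mod i N = toℕ-fromℕ< (m%n<n i N)

mod-toℕ : ∀ {K} (i : Fin (suc K)) → toℕ i mod suc K ≡ i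
mod-toℕ {K} i = toℕ-injective (trans (toℕ-mod (toℕ i) (suc K)) (m<n⇒m%n≡m (toℕ<n i)))

next-mod : ∀ {K} i → next (i mod suc K) ≡ suc i mod suc K
next-mod {K} i = toℕ-injective (begin
  toℕ (next (i mod N))       ≡⟨ toℕ-mod (suc (toℕ (i mod N))) N ⟩
  suc (toℕ (i mod N)) % N    ≡⟨ cong (λ x → suc x % N) (toℕ-mod i N) ⟩
  (1 + i % N) % N            ≡⟨ %-distribˡ-+ 1 (i % N) N ⟩
  (1 % N + i % N % N) % N    ≡⟨ cong (λ x → (1 % N + x) % N) (m%n%n≡m%n i N) ⟩
  (1 % N + i % N) % N        ≡⟨ %-distribˡ-+ 1 i N ⟨
  (1 + i) % N                ≡⟨ toℕ-mod (suc i) N ⟨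
  toℕ (suc i mod N)          ∎)
  where
  open ≡-Reasoning
  N = suc K

-- The words of MT(w)

module Cycle {n K : ℕ} (W : ℕ → Fin n) (periodic : ∀ k → W (k + suc K) ≡ W k)
  (rr : Fin (suc K) → Order n)
  (rr-isOrder : ∀ i → IsOrder (rr i))
  (rr-least : ∀ i j → i ≢ j → Less W (rr i) (toℕ i) (toℕ j))
  (rr-onto : ∀ s → IsOrder s → ∃[ i ] (∀ a → rr i a ≡ s a))
  where

  open Periodic W periodic public

  r : ℕ → Order n
  r i = rr (i mod N)

  mod-~ : ∀ i → _~_ W (toℕ (i mod N)) i
  mod-~ i k = trans (cong (λ x → W (x + k)) (toℕ-mod i N)) (%-~ i k)

  r-less : ∀ {i j} → i mod N ≢ j mod N → Less W (r i) i j
  r-less {i} {j} i≢j with rr-least (i mod N) (j mod N) i≢j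
  ... | m , agr , lt = m , (λ k k<m → trans (sym (mod-~ i k)) (trans (agr k k<m) (mod-~ j k))) ,
    subst₂ (LtL (r i)) (mod-~ i m) (mod-~ j m) lt

  -- `W` has no smaller period: `Less` exhibits a letter in which the suffixes of two distinct
  -- residues differ.
  ~⇒mod : ∀ {i j} → _~_ W i j → i mod N ≡ j mod N
  ~⇒mod {i} {j} same with i mod N ≟ j mod N
  ... | yes eq = eq
  ... | no neq with r-less {i} {j} neq
  ...   | m , _ , lt = contradiction (same m) (LtL⇒≢ (r i) lt)

  mod⇒~ : ∀ {i j} → i mod N ≡ j mod N → _~_ W i j
  mod⇒~ {i} {j} eq k = trans (sym (mod-~ i k)) (trans (cong (λ x → W (toℕ x + k)) eq) (mod-~ j k))

  r-least : ∀ i j → _~_ W i j ⊎ Less W (r i) i j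
  r-least i j with i mod N ≟ j mod N
  ... | yes eq = inj₁ (mod⇒~ eq)
  ... | no neq = inj₂ (r-less neq)

  r-resp : ∀ {i j} → _~_ W i j → ∀ a → r i a ≡ r j a
  r-resp same a = cong (λ x → rr x a) (~⇒mod same)

  r-onto : ∀ s → IsOrder s → ∃[ i ] (∀ a → r i a ≡ s a)
  r-onto s s-ord with rr-onto s s-ord
  ... | i , eq = toℕ i , λ a → trans (cong (λ x → rr x a) (mod-toℕ i)) (eq a)

  open FirstOccurrence W r (λ i → rr-isOrder (i mod N)) r-least r-resp r-onto

  MT[W] : Word n → Set
  MT[W] = MT (window W 0 N)

  Unique : ℕ → ℕ → Set
  Unique i ℓ = ∀ j → window W j ℓ ≡ window W i ℓ → _~_ W i j

  Repeated : ℕ → ℕ → Set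
  Repeated i ℓ = ∃[ j ] window W j ℓ ≡ window W i ℓ × ¬ (_~_ W i j)

  -- The shortest nonempty factor from `i` that occurs once around the cycle. Minimality is stored
  -- as explicit second occurrences, which the branching condition of a lex-code asks for.
  record Key (i ℓ : ℕ) : Set where
    field
      nonempty : 1 ≤ ℓ
      unique   : Unique i ℓ
      repeated : ∀ {ℓ′} → 1 ≤ ℓ′ → ℓ′ < ℓ → Repeated i ℓ′
  open Key

  unique⇒¬repeated : ∀ {i ℓ} → Unique i ℓ → ¬ Repeated i ℓ
  unique⇒¬repeated uniq (j , eq , i≁j) = i≁j (uniq j eq)

  unique-N : ∀ i → Unique i N
  unique-N i j eq = agree-N⇒~ (window⇒agree N (sym eq))

  tri⇒LtL : ∀ {i ℓ a b} → Tri (window W i ℓ) a b → LtL (r i) a b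
  tri⇒LtL {i} {ℓ} t with tri⇒position {W = W} t
  ... | p , p<ℓ , refl , unseen = ranked ℓ i p<ℓ unseen

  -- At a first difference, leastness makes `r i` and `r j` compare the two letters in opposite
  -- ways, but both contain the total relation `R`.
  same-tri⇒~ : ∀ {R i j} → IsStrictTotal R → (∀ {a b} → R a b → LtL (r i) a b) → (∀ {a b} → R a b → LtL (r j) a b) →
    _~_ W i j
  same-tri⇒~ {R} {i} {j} (_ , _ , total) R⇒i R⇒j with r-least i j
  ... | inj₁ same = same
  ... | inj₂ (m , agr , x<y) with total _ _ (LtL⇒≢ (r i) x<y)
  ...   | inj₁ Rxy = contradiction (R⇒j Rxy) (<-asym (least-at (λ k k<m → sym (agr k k<m)) (LtL⇒≢ (r i) x<y ∘ sym)))
  ...   | inj₂ Ryx = contradiction (R⇒i Ryx) (<-asym x<y)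

  total⇒unique : ∀ {i ℓ} → IsStrictTotal (Tri (window W i ℓ)) → Unique i ℓ
  total⇒unique {i} {ℓ} total j eq = same-tri⇒~ total (tri⇒LtL {i} {ℓ})
    (λ {a} {b} t → tri⇒LtL {j} {ℓ} (subst (λ u → Tri u a b) (sym eq) t))

  abstract
    -- Totality can fail only through two missing letters, and these force a second occurrence.
    total-or-repeated : ∀ i ℓ → IsStrictTotal (Tri (window W i ℓ)) ⊎ Repeated i ℓ
    total-or-repeated i ℓ = [ inj₁ , (λ (_ , _ , a≢b , a∉ , b∉) → inj₂ (repeat a≢b a∉ b∉)) ]′ (tri-total? {W = W} i ℓ)
      where
      repeat : ∀ {a b} → a ≢ b → a ∉ window W i ℓ → b ∉ window W i ℓ → Repeated i ℓ
      repeat a≢b a∉ b∉ =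
        let j , agr , i≁j = missing-pair⇒repeated a≢b (∉-window⇒unseen a∉) (∉-window⇒unseen b∉)
        in j , agree⇒window ℓ agr , i≁j

  unique⇒total : ∀ {i ℓ} → Unique i ℓ → IsStrictTotal (Tri (window W i ℓ))
  unique⇒total {i} {ℓ} uniq with total-or-repeated i ℓ
  ... | inj₁ total = total
  ... | inj₂ rep = contradiction rep (unique⇒¬repeated uniq)

  abstract
    -- Lengths are tried upwards; the search succeeds by length `N`, since a full period determines
    -- the suffix.
    key-exists : ∀ i → ∃[ ℓ ] Key i ℓ
    key-exists i with search N
      where
      search : ∀ b → (∃[ ℓ ] Key i ℓ) ⊎ (∀ {ℓ} → 1 ≤ ℓ → ℓ ≤ b → Repeated i ℓ)
      search zero = inj₂ (λ { (s≤s _) () })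
      search (suc b) with search b
      ... | inj₁ found = inj₁ found
      ... | inj₂ shorter with total-or-repeated i (suc b)
      ...   | inj₁ total = inj₁ (suc b , record
        { nonempty = s≤s z≤n ; unique = total⇒unique total ; repeated = λ 1≤ℓ ℓ≤b → shorter 1≤ℓ (s≤s⁻¹ ℓ≤b) })
      ...   | inj₂ rep = inj₂ λ 1≤ℓ ℓ≤ → [ (λ ℓ<b → shorter 1≤ℓ (s≤s⁻¹ ℓ<b)) , (λ { refl → rep }) ]′ (m≤n⇒m<n∨m≡n ℓ≤)
    ... | inj₁ found = found
    ... | inj₂ all-repeated = contradiction (all-repeated (s≤s z≤n) ≤-refl) (unique⇒¬repeated (unique-N i))

  unique-key-≤ : ∀ {i ℓ ℓ′} → 1 ≤ ℓ → Unique i ℓ → Key i ℓ′ → ℓ′ ≤ ℓ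
  unique-key-≤ {i} {ℓ} {ℓ′} 1≤ℓ uniq key with ℓ′ ≤? ℓ
  ... | yes le = le
  ... | no ¬le = contradiction (repeated key 1≤ℓ (≰⇒> ¬le)) (unique⇒¬repeated uniq)

  key-unique : ∀ {i ℓ ℓ′} → Key i ℓ → Key i ℓ′ → ℓ ≡ ℓ′
  key-unique k k′ = ≤-antisym (unique-key-≤ (nonempty k′) (unique k′) k) (unique-key-≤ (nonempty k) (unique k) k′)

  key-resp : ∀ {i j ℓ} → _~_ W i j → Key i ℓ → Key j ℓ
  key-resp {i} {j} same key = record
    { nonempty = nonempty key
    ; unique = λ x eq k → trans (sym (same k)) (unique key x (trans eq (sym (~⇒window same _))) k)
    ; repeated = λ 1≤ℓ ℓ< → case repeated key 1≤ℓ ℓ< of λ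
        { (x , eq , i≁x) → x , trans eq (~⇒window same _) , λ j~x → i≁x (λ k → trans (same k) (j~x k)) } }

  abstract
    -- A shorter prefix with a total relation would have the same relation as `u`, because both
    -- coincide with the order `r i`. Minimality in `MT` therefore makes every shorter prefix
    -- repeat.
    MT⇒key : ∀ {u} → MT[W] u → ∃₂ λ i ℓ → u ≡ window W i ℓ × Key i ℓ
    MT⇒key (cyclic , total , minimal) with cyclicFactor⇒window cyclic
    ... | i , ℓ , 1≤ℓ , refl = i , ℓ , refl , record
      { nonempty = 1≤ℓ
      ; unique = total⇒unique total
      ; repeated = shorter }
      where
      shorter : ∀ {ℓ′} → 1 ≤ ℓ′ → ℓ′ < ℓ → Repeated i ℓ′
      shorter {ℓ′} 1≤ℓ′ ℓ′<ℓ with total-or-repeated i ℓ′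
      ... | inj₂ rep = rep
      ... | inj₁ total′ = contradiction same-tri (minimal (window W i ℓ′)
        (window≢[] 1≤ℓ′ , (λ eq → <-irrefl (window-lengths {W = W} eq) ℓ′<ℓ) , [] , prefix-window i (<⇒≤ ℓ′<ℓ)))
        where
        LtL⇒tri : ∀ {ℓ a b} → IsStrictTotal (Tri (window W i ℓ)) → LtL (r i) a b → Tri (window W i ℓ) a b
        LtL⇒tri {ℓ} {a} {b} (_ , _ , tot) a<b with tot a b (LtL⇒≢ (r i) a<b)
        ... | inj₁ t = t
        ... | inj₂ t = contradiction (tri⇒LtL {i} {ℓ} t) (<-asym a<b)
        same-tri : SameTri (window W i ℓ′) (window W i ℓ)
        same-tri a b = mk⇔ (LtL⇒tri {ℓ} total ∘ tri⇒LtL {i} {ℓ′}) (LtL⇒tri {ℓ′} total′ ∘ tri⇒LtL {i} {ℓ})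

  -- A proper factor with the same total relation must start at a position equivalent to `i`. It is
  -- then a shorter prefix of the key that occurs only once.
  key⇒MT : ∀ {i ℓ} → Key i ℓ → MT[W] (window W i ℓ)
  key⇒MT {i} {ℓ} key =
    window⇒cyclicFactor i (nonempty key) (unique-key-≤ (s≤s z≤n) (unique-N i) key) , total , minimal
    where
    total : IsStrictTotal (Tri (window W i ℓ))
    total = unique⇒total (unique key)
    minimal : ∀ v → ProperFactor v (window W i ℓ) → ¬ SameTri v (window W i ℓ)
    minimal v (v≢[] , v≢u , p , s , eq) same with ++≡window p {v ++ s} eq
    ... | _ , vs≡ , lengths with ++≡window v {s} vs≡
    ...   | v≡ , _ , lengths′ = contradiction (repeated key (length-positive v≢[]) |v|<ℓ) (unique⇒¬repeated v-unique)
      where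
      j = i + length p
      i~j : _~_ W i j
      i~j = same-tri⇒~ total (tri⇒LtL {i} {ℓ}) (λ {a} {b} t →
        tri⇒LtL {j} {length v} (subst (λ x → Tri x a b) v≡ (Equivalence.from (same a b) t)))
      v-at-i : v ≡ window W i (length v)
      v-at-i = trans v≡ (sym (~⇒window i~j _))
      |v|<ℓ : length v < ℓ
      |v|<ℓ with m≤n⇒m<n∨m≡n (≤-trans (m≤m+n (length v) (length s)) (≤-trans (≤-reflexive lengths′)
        (≤-trans (m≤n+m (length (v ++ s)) (length p)) (≤-reflexive lengths))))
      ... | inj₁ lt = lt
      ... | inj₂ eq′ = contradiction (trans v-at-i (cong (window W i) eq′)) v≢u
      v-unique : Unique i (length v)
      v-unique x eq′ = same-tri⇒~ total (tri⇒LtL {i} {ℓ}) (λ {a} {b} t →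
        tri⇒LtL {x} {length v} (subst (λ y → Tri y a b) (trans v-at-i (sym eq′)) (Equivalence.from (same a b) t)))

  -- Both keys reach past the first difference of the suffixes, since otherwise one of them would
  -- occur at the other position too.
  key-lex : ∀ {i j ℓ ℓ′} → Key i ℓ → Key j ℓ′ → ¬ (_~_ W i j) → Lex (r i) (window W i ℓ) (window W j ℓ′)
  key-lex {i} {j} {ℓ} {ℓ′} key key′ i≁j with r-least i j
  ... | inj₁ same = contradiction same i≁j
  ... | inj₂ less@(m , agr , lt) = less⇒lex {r = r i} less (long key i≁j (λ k k<m → sym (agr k k<m))) (long key′ (λ e → i≁j (λ k → sym (e k))) agr)
    where
    long : ∀ {x y l} → Key x l → ¬ (_~_ W x y) → Agree W y x m → m < l
    long {x} {y} {l} k x≁y agr′ with suc m ≤? l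
    ... | yes le = le
    ... | no ¬le = contradiction (unique k y (agree⇒window l (λ q q<l → agr′ q (<-≤-trans q<l (≮⇒≥ ¬le))))) x≁y

  key-windows : ∀ {i j ℓ ℓ′} → Key i ℓ → window W j ℓ′ ≡ window W i ℓ → _~_ W i j
  key-windows {i} {j} key eq with window-lengths {W = W} eq
  ... | refl = unique key j eq

  key-lexMin : ∀ {i ℓ} → Key i ℓ → LexMin (r i) MT[W] (window W i ℓ)
  key-lexMin {i} {ℓ} key = key⇒MT key , below
    where
    below : ∀ y → MT[W] y → y ≡ window W i ℓ ⊎ Lex (r i) (window W i ℓ) y
    below y y∈ with MT⇒key y∈
    ... | j , ℓ′ , refl , key′ with i mod N ≟ j mod N
    ...   | no neq = inj₂ (key-lex key key′ (neq ∘ ~⇒mod))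
    ...   | yes eq with key-unique key (key-resp (mod⇒~ (sym eq)) key′)
    ...     | refl = inj₁ (~⇒window (mod⇒~ {j} {i} (sym eq)) ℓ)

  MT-lexCode : LexCode n MT[W]
  MT-lexCode = own-order , branching
    where
    own-order : ∀ x → MT[W] x → Σ (Order n) λ s → IsOrder s × LexMin s MT[W] x
      × (∀ s′ → IsOrder s′ → LexMin s′ MT[W] x → ∀ a → s′ a ≡ s a)
    own-order x x∈ with MT⇒key x∈
    ... | i , ℓ , refl , key = r i , (λ {a} {b} → rr-isOrder (i mod N) {a} {b}) , key-lexMin key , only
      where
      only : ∀ s′ → IsOrder s′ → LexMin s′ MT[W] (window W i ℓ) → ∀ a → s′ a ≡ r i a
      -- Some position `j` carries the order `s′`. Its key is also minimal for `s′`, so the two keys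
      -- coincide and the positions have the same order.
      only s′ s′-ord (_ , min) a with r-onto s′ s′-ord
      ... | j , rj≗ with key-exists j
      ...   | ℓ′ , key′ with min (window W j ℓ′) (key⇒MT key′) | proj₂ (key-lexMin key′) (window W i ℓ) x∈
      ...     | inj₁ eq | _ = trans (sym (rj≗ a)) (r-resp (λ k → sym (key-windows key eq k)) a)
      ...     | inj₂ _ | inj₁ eq = trans (sym (rj≗ a)) (r-resp (key-windows key′ eq) a)
      ...     | inj₂ lt | inj₂ gt = contradiction (lex-resp {r = r j} rj≗ gt) (lex-asym {r = s′} lt)
    branching : ∀ x p → MT[W] x → ProperPrefix p x →
      Σ (Word n) λ y → Σ (Word n) λ z → MT[W] y × MT[W] z × y ≢ z × Prefix p y × Prefix p z
    branching x [] x∈ (p≢[] , _) = contradiction refl p≢[]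
    branching x p@(_ ∷ p′) x∈ (_ , p≢x , s , p++s≡x) with MT⇒key x∈
    ... | i , ℓ , refl , key with ++≡window p p++s≡x
    ...   | p≡ , _ , lengths with m≤n⇒m<n∨m≡n (m+n≤o⇒m≤o (length p) (≤-reflexive lengths))
    ...     | inj₂ eq = contradiction (trans p≡ (cong (window W i) eq)) p≢x
    ...     | inj₁ |p|<ℓ with repeated key (s≤s z≤n) |p|<ℓ
    ...       | j , eq , i≁j with key-exists j
    ...         | ℓ′ , key′ = window W i ℓ , window W j ℓ′ , x∈ , key⇒MT key′ ,
                  (λ eq′ → i≁j (key-windows key (sym eq′))) , (s , p++s≡x) ,
                  subst (λ y → Prefix y (window W j ℓ′)) (trans eq (sym p≡)) (prefix-window j |p|≤ℓ′)
      where
      -- Otherwise the key at `j` would be a prefix of `p` and hence occur at `i` as well.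
      |p|≤ℓ′ : length p ≤ ℓ′
      |p|≤ℓ′ with length p ≤? ℓ′
      ... | yes le = le
      ... | no ¬le = contradiction
        (λ k → sym (unique key′ i (window-shorter {i = i} {j} (<⇒≤ (≰⇒> ¬le)) (sym eq)) k)) i≁j

  -- Prepending `W i` to the key at `suc i` gives a factor that occurs once. This is the edge
  -- condition of the Hamiltonian cycle.
  key-length-suc : ∀ {i ℓ ℓ′} → Key i ℓ → Key (suc i) ℓ′ → ℓ ≤ suc ℓ′
  key-length-suc {i} {ℓ} {ℓ′} key key′ = unique-key-≤ (s≤s z≤n)
    (λ j eq → shift-~ W (sym (∷-injectiveˡ eq)) (unique key′ (suc j) (∷-injectiveʳ eq))) key

  MT-hamiltonian : Hamiltonian MT[W]
  MT-hamiltonian = K , c , c-injective , (λ i → key⇒MT (c-key i)) , c-onto , edge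
    where
    ℓ : ℕ → ℕ
    ℓ i = proj₁ (key-exists i)
    c : Fin N → Word n
    c i = window W (toℕ i) (ℓ (toℕ i))
    c-key : ∀ i → Key (toℕ i) (ℓ (toℕ i))
    c-key i = proj₂ (key-exists (toℕ i))
    c-injective : Injective _≡_ _≡_ c
    c-injective {i} {j} eq = trans (sym (mod-toℕ i)) (trans (~⇒mod (key-windows (c-key i) (sym eq))) (mod-toℕ j))
    c-onto : ∀ x → MT[W] x → ∃[ i ] c i ≡ x
    c-onto x x∈ with MT⇒key x∈
    ... | i , l , refl , key = i mod N , trans (~⇒window (mod-~ i) _)
      (cong (window W i) (key-unique (key-resp (mod-~ i) (c-key (i mod N))) key))
    edge : ∀ i → Edge (c i) (c (next i))
    -- `next` wraps around at the last position, so the key there is first carried over to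
    -- `suc (toℕ i)`.
    edge i = W (toℕ i) , subst (λ u → Prefix (c i) (W (toℕ i) ∷ u))
      (sym (~⇒window (mod-~ (suc (toℕ i))) _))
      (prefix-window (toℕ i) (key-length-suc (c-key i) (key-resp (mod-~ (suc (toℕ i))) (c-key (next i)))))

-- From universal Lyndon words to lex-codes

less-asym : ∀ {n} {W : ℕ → Fin n} {r i j} → Less W r i j → ¬ Less W r j i
less-asym {W = W} {r} (m , agr , lt) gt = contradiction lt (<-asym
  (first-difference {W = W} {r = r} (λ k k<m → sym (agr k k<m)) (LtL⇒≢ r lt ∘ sym) gt))

less-resp : ∀ {n} {W : ℕ → Fin n} {r s : Order n} → (∀ a → r a ≡ s a) → ∀ {i j} → Less W r i j → Less W s i j
less-resp {r = r} {s} r≗s (m , agr , lt) = m , agr , LtL-resp {r = r} {s} r≗s lt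

-- If two positions shared an order, each suffix would be strictly smaller than the other.
encode-least-injective : ∀ {n K} {W : ℕ → Fin n} {rr : Fin K → Order n} (ord : ∀ i → IsOrder (rr i)) →
  (∀ i j → i ≢ j → Less W (rr i) (toℕ i) (toℕ j)) → Injective _≡_ _≡_ (λ i → encode n (rr i) (ord i))
encode-least-injective {n} {W = W} {rr} ord least {i} {j} eq with i ≟ j
... | yes i≡j = i≡j
... | no i≢j = contradiction (least j i (i≢j ∘ sym))
  (less-asym {W = W} {rr j} (less-resp {W = W} {rr i} {rr j} (encode-injective n (ord i) (ord j) eq) (least i j i≢j)))

-- Finds where to cut rotation `i` so that rotation `j` arises as a proper conjugate; a period is
-- added when `j` comes first.
rotation-gap : ∀ {K} {i j : Fin (suc K)} → i ≢ j →
  ∃[ s ] 0 < s × s < suc K × (toℕ i + s ≡ toℕ j ⊎ toℕ i + s ≡ toℕ j + suc K)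
rotation-gap {K} {i} {j} i≢j with <-cmp (toℕ i) (toℕ j)
... | tri< i<j _ _ = toℕ j ∸ toℕ i , m<n⇒0<n∸m i<j , ≤-<-trans (m∸n≤m (toℕ j) (toℕ i)) (toℕ<n j) , inj₁ (m+[n∸m]≡n (<⇒≤ i<j))
... | tri≈ _ eq _ = contradiction (toℕ-injective eq) i≢j
... | tri> _ _ j<i = toℕ j + suc K ∸ toℕ i , m<n⇒0<n∸m i<j+N , s<N , inj₂ (m+[n∸m]≡n (<⇒≤ i<j+N))
  where
  i<j+N : toℕ i < toℕ j + suc K
  i<j+N = <-≤-trans (toℕ<n i) (m≤n+m (suc K) (toℕ j))
  s<N : toℕ j + suc K ∸ toℕ i < suc K
  s<N = +-cancelˡ-< (toℕ i) _ _ (<-≤-trans (s≤s (≤-reflexive (m+[n∸m]≡n (<⇒≤ i<j+N)))) (+-monoˡ-≤ (suc K) j<i))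

rotation-moves : ∀ {K} t {s} → 0 < s → s < suc K → (t + s) mod suc K ≢ t mod suc K
rotation-moves {K} t {s} 0<s s<N eq = [ unwrapped , wrapped ]′ (<-≤-connex (i + s) N)
  where
  N = suc K
  i = t % N
  i+s%N≡i : (i + s) % N ≡ i
  i+s%N≡i = begin
    (i + s) % N          ≡⟨ cong (λ x → (i + x) % N) (m<n⇒m%n≡m s<N) ⟨
    (i + s % N) % N      ≡⟨ %-distribˡ-+ t s N ⟨
    (t + s) % N          ≡⟨ toℕ-mod (t + s) N ⟨
    toℕ ((t + s) mod N)  ≡⟨ cong toℕ eq ⟩
    toℕ (t mod N)        ≡⟨ toℕ-mod t N ⟩
    i                    ∎
    where open ≡-Reasoning
  unwrapped : i + s < N → ⊥
  unwrapped lt = <-irrefl (sym (trans (sym (m<n⇒m%n≡m lt)) i+s%N≡i)) (m<m+n i 0<s)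
  wrapped : N ≤ i + s → ⊥
  wrapped N≤i+s = <-irrefl s≡N s<N
    where
    j = i + s ∸ N
    j<N : j < N
    j<N = +-cancelʳ-< N j N (<-≤-trans (s≤s (≤-reflexive (m∸n+n≡m N≤i+s))) (+-mono-<-≤ (m%n<n t N) (<⇒≤ s<N)))
    j≡i : j ≡ i
    j≡i = trans (sym (m<n⇒m%n≡m j<N)) (trans (m≤n⇒[n∸m]%m≡n%m N≤i+s) i+s%N≡i)
    s≡N : s ≡ N
    s≡N = +-cancelˡ-≡ i s N (trans (sym (m∸n+n≡m N≤i+s)) (cong (_+ N) j≡i))

module _ {n K : ℕ} (W : ℕ → Fin n) (periodic : ∀ k → W (k + suc K) ≡ W k) where
  open Periodic W periodic

  lyndon⇒least : ∀ {r} (i j : Fin N) → i ≢ j →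
    (∀ c → ProperConjugate c (window W (toℕ i) N) → Lex r (window W (toℕ i) N) c) → Less W r (toℕ i) (toℕ j)
  lyndon⇒least {r} i j i≢j minimal with rotation-gap i≢j
  ... | s , 0<s , s<N , gap with window-rotated (toℕ i) (<⇒≤ s<N)
  ...   | eq , eq′ with lex⇒less {W = W} {r = r} {toℕ i} {toℕ j} {N} {N} (minimal (window W (toℕ j) N)
            (window W (toℕ i) s , window W (toℕ i + s) (N ∸ s) , window≢[] 0<s , window≢[] (m<n⇒0<n∸m s<N) , eq ,
             trans (~⇒window {W = W} j~ N) eq′))
    where
    j~ : _~_ W (toℕ j) (toℕ i + s)
    j~ = [ (λ e k → cong (λ x → W (x + k)) (sym e)) ,
           (λ e k → trans (sym (+N-~ (toℕ j) k)) (cong (λ x → W (x + k)) (sym e))) ]′ gap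
  ...     | inj₁ (N<N , _) = contradiction N<N (<-irrefl refl)
  ...     | inj₂ less = less

window-lookup : ∀ {n} {W : ℕ → Fin n} i (u : Word n) → (∀ k → W (i + toℕ k) ≡ lookup u k) → window W i (length u) ≡ u
window-lookup i [] eq = refl
window-lookup {W = W} i (a ∷ u) eq = cong₂ _∷_ (trans (cong W (sym (+-identityʳ i))) (eq zero))
  (window-lookup (suc i) u (λ k → trans (cong W (sym (+-suc i (toℕ k)))) (eq (suc k))))

forward : ∀ n (w : Word n) → UniversalLyndon n w → LexCode n (MT w) × Hamiltonian (MT w)
-- `n !` is positive, so the word is nonempty and the period has the form `suc K`.
forward n [] (len , _) = contradiction len (λ eq → <-irrefl eq (1≤n! n))
forward n w@(a ∷ w′) (len , lyndon) =
  subst (λ u → LexCode n (MT u) × Hamiltonian (MT u)) whole (MT-lexCode , MT-hamiltonian)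
  where
  K = length w′
  W : ℕ → Fin n
  W k = lookup w (k mod suc K)
  periodic : ∀ k → W (k + suc K) ≡ W k
  periodic k = cong (lookup w) (toℕ-injective
    (trans (toℕ-mod (k + suc K) (suc K)) (trans ([m+n]%n≡m%n k (suc K)) (sym (toℕ-mod k (suc K))))))
  whole : window W 0 (suc K) ≡ w
  whole = window-lookup 0 w (λ k → cong (lookup w) (mod-toℕ k))
  rotation-lyndon : ∀ (i : Fin (suc K)) → Lyndon (window W (toℕ i) (suc K))
  rotation-lyndon i = let eq , eq′ = Periodic.window-rotated W periodic 0 (<⇒≤ (toℕ<n i))
    in lyndon _ (window W 0 (toℕ i) , window W (toℕ i) (suc K ∸ toℕ i) , trans (sym whole) eq , eq′)
  rr : Fin (suc K) → Order n
  rr i = proj₁ (rotation-lyndon i)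
  rr-isOrder : ∀ i → IsOrder (rr i)
  rr-isOrder i = proj₁ (proj₂ (rotation-lyndon i))
  rr-least : ∀ i j → i ≢ j → Less W (rr i) (toℕ i) (toℕ j)
  rr-least i j i≢j = lyndon⇒least W periodic i j i≢j (proj₂ (proj₂ (rotation-lyndon i)))
  rr-onto : ∀ s → IsOrder s → ∃[ i ] (∀ a → rr i a ≡ s a)
  -- Distinct positions have distinct orders and there are as many positions as orders, so none is
  -- left out.
  rr-onto s s-ord = let i , eq = injective⇒surjective len (encode-least-injective {W = W} rr-isOrder rr-least) (encode n s s-ord)
    in i , encode-injective n (rr-isOrder i) s-ord eq
  open Cycle W periodic rr rr-isOrder rr-least rr-onto

-- From lex-codes to universal Lyndon words

module Converse {n : ℕ} (2≤n : 2 ≤ n) (X : Word n → Set) (code : LexCode n X)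
  {K : ℕ} (c : Fin (suc K) → Word n) (c-injective : Injective _≡_ _≡_ c)
  (c∈X : ∀ i → X (c i)) (c-onto : ∀ x → X x → ∃[ i ] c i ≡ x)
  (c-edge : ∀ i → Edge (c i) (c (next i)))
  where

  -- A proper prefix is smaller in every order, so the longer word could never be the minimum.
  prefix-free : ∀ {x y} → X x → X y → Prefix x y → x ≡ y
  prefix-free {x} {y} x∈ y∈ (s , x++s≡y) with proj₁ code y y∈
  ... | r , _ , (_ , min) , _ with min x x∈
  ...   | inj₁ x≡y = x≡y
  ...   | inj₂ y<x = split s x++s≡y
    where
    split : ∀ s → x ++ s ≡ y → x ≡ y
    split [] eq = trans (sym (++-identityʳ x)) eq
    split (a ∷ s) eq = contradiction y<x (lex-asym {r = r} (inj₁ (a ∷ s , (λ ()) , eq)))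

  -- The empty word would be minimal for all orders, but two letters admit two different orders,
  -- against uniqueness.
  nonempty : ∀ {x} → X x → x ≢ []
  nonempty x∈ refl with proj₁ code [] x∈
  ... | r , _ , _ , unique = a≢b (trans (unique id id (min-[] id) a)
    (trans (sym (unique (transpose a b) (transpose-injective a b) (min-[] (transpose a b)) a)) (transpose-left a b)))
    where
    a b : Fin n
    a = fromℕ< (≤-trans (s≤s z≤n) 2≤n)
    b = fromℕ< 2≤n
    a≢b : a ≢ b
    a≢b eq = case trans (sym (toℕ-fromℕ< _)) (trans (cong toℕ eq) (toℕ-fromℕ< 2≤n)) of λ ()
    min-[] : ∀ s → LexMin s X []
    min-[] s = x∈ , λ { [] _ → inj₁ refl ; (d ∷ y) _ → inj₂ (inj₁ (d ∷ y , (λ ()) , refl)) }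

  uncons : ∀ i → ∃₂ λ a u → c i ≡ a ∷ u
  uncons i with c i in eq
  ... | [] = contradiction eq (nonempty (c∈X i))
  ... | a ∷ u = a , u , refl

  W : ℕ → Fin n
  W k = proj₁ (uncons (k mod suc K))

  C : ℕ → Word n
  C k = c (k mod suc K)

  periodic : ∀ k → W (k + suc K) ≡ W k
  periodic k = cong (λ i → proj₁ (uncons i)) (toℕ-injective
    (trans (toℕ-mod (k + suc K) (suc K)) (trans ([m+n]%n≡m%n k (suc K)) (sym (toℕ-mod k (suc K))))))

  C-edge : ∀ k → Edge (C k) (C (suc k))
  C-edge k = let a , s , eq = c-edge (k mod suc K)
    in a , s , trans eq (cong (λ i → a ∷ c i) (next-mod k))

  -- The head of C k is W k, and an edge says that the tail of C k is a prefix of C (suc k).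
  prefix⇒window : ∀ u k → Prefix u (C k) → u ≡ window W k (length u)
  prefix⇒window [] k _ = refl
  prefix⇒window (a ∷ u) k (s , a∷u++s≡) with proj₂ (uncons (k mod suc K)) | C-edge k
  ... | t , C≡ | b , s′ , C++s′≡ =
    cong₂ _∷_ (∷-injectiveˡ (trans a∷u++s≡ C≡)) (prefix⇒window u (suc k) (s ++ s′ , (begin
      u ++ s ++ s′     ≡⟨ ++-assoc u s s′ ⟨
      (u ++ s) ++ s′   ≡⟨ cong (_++ s′) (∷-injectiveʳ (trans a∷u++s≡ C≡)) ⟩
      t ++ s′          ≡⟨ ∷-injectiveʳ (trans (cong (_++ s′) (sym C≡)) C++s′≡) ⟩
      C (suc k)        ∎)))
    where open ≡-Reasoning

  L : ℕ → ℕ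
  L k = length (C k)

  C-window : ∀ k → C k ≡ window W k (L k)
  C-window k = prefix⇒window (C k) k ([] , ++-identityʳ (C k))

  C-toℕ : ∀ i → C (toℕ i) ≡ c i
  C-toℕ i = cong c (mod-toℕ i)

  rr : Fin (suc K) → Order n
  rr i = proj₁ (proj₁ code (c i) (c∈X i))

  rr-isOrder : ∀ i → IsOrder (rr i)
  rr-isOrder i = proj₁ (proj₂ (proj₁ code (c i) (c∈X i)))

  rr-min : ∀ i j → i ≢ j → Lex (rr i) (C (toℕ i)) (C (toℕ j))
  rr-min i j i≢j with proj₂ (proj₁ (proj₂ (proj₂ (proj₁ code (c i) (c∈X i))))) (c j) (c∈X j)
  ... | inj₁ eq = contradiction (c-injective (sym eq)) i≢j
  ... | inj₂ lt = subst₂ (Lex (rr i)) (sym (C-toℕ i)) (sym (C-toℕ j)) lt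

  rr-least : ∀ i j → i ≢ j → Less W (rr i) (toℕ i) (toℕ j)
  rr-least i j i≢j with lex⇒less {W = W} {r = rr i} {toℕ i} {toℕ j} {L (toℕ i)} {L (toℕ j)}
    (subst₂ (Lex (rr i)) (C-window (toℕ i)) (C-window (toℕ j)) (rr-min i j i≢j))
  ... | inj₂ less = less
  ... | inj₁ (Li<Lj , eq) = contradiction
    (c-injective (trans (sym (C-toℕ i)) (trans (prefix-free (c∈X _) (c∈X _) prefix) (C-toℕ j)))) i≢j
    where
    prefix : Prefix (C (toℕ i)) (C (toℕ j))
    prefix = subst₂ Prefix (trans (sym eq) (sym (C-window (toℕ i)))) (sym (C-window (toℕ j)))
      (prefix-window {W = W} (toℕ j) (<⇒≤ Li<Lj))

  -- The finite code has a minimum for `s`, and by uniqueness `s` is the order assigned to that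
  -- word.
  rr-onto : ∀ s → IsOrder s → ∃[ i ] (∀ a → rr i a ≡ s a)
  rr-onto s s-ord with lexMinimum {r = s} s-ord c
  ... | i , min = i , λ a → sym (proj₂ (proj₂ (proj₂ (proj₁ code (c i) (c∈X i)))) s s-ord (c∈X i , below) a)
    where
    below : ∀ y → X y → y ≡ c i ⊎ Lex s (c i) y
    below y y∈ with c-onto y y∈
    ... | j , refl = min j

  -- Code words inject into orders, and orders into code words by choosing the position found for
  -- each.
  N≡n! : suc K ≡ n !
  N≡n! = ≤-antisym (injective⇒≤ (encode-least-injective {W = W} rr-isOrder rr-least)) (injective⇒≤ position-injective)
    where
    position : Fin (n !) → Fin (suc K)
    position x = proj₁ (rr-onto (decode n x) (decode-isOrder n x))
    position-injective : Injective _≡_ _≡_ position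
    position-injective {x} {y} eq = decode-injective n λ a →
      trans (sym (proj₂ (rr-onto (decode n x) (decode-isOrder n x)) a))
        (trans (cong (λ i → rr i a) eq) (proj₂ (rr-onto (decode n y) (decode-isOrder n y)) a))

  open Cycle W periodic rr rr-isOrder rr-least rr-onto

  universal : UniversalLyndon n (window W 0 N)
  universal = trans (length-window {W = W} 0 N) N≡n! , λ { _ (w₁ , w₂ , eq , refl) →
    subst Lyndon (sym (rotate 0 w₁ (sym eq))) (rotation-lyndon (length w₁)) }
    where
    rotation-lyndon : ∀ t → Lyndon (window W t N)
    rotation-lyndon t = r t , (λ {a} {b} → rr-isOrder (t mod N) {a} {b}) , minimal
      where
      minimal : ∀ c′ → ProperConjugate c′ (window W t N) → Lex (r t) (window W t N) c′
      minimal _ ([] , _ , w₁≢[] , _) = contradiction refl w₁≢[]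
      minimal _ (_ , [] , _ , w₂≢[] , _) = contradiction refl w₂≢[]
      minimal _ (w₁@(_ ∷ _) , w₂@(_ ∷ _) , _ , _ , eq , refl) with ++≡window {W = W} w₁ (sym eq)
      ... | _ , _ , lengths = subst (Lex (r t) (window W t N)) (sym (rotate t w₁ (sym eq)))
          (lex (r-less {t} {t + length w₁} (rotation-moves t (s≤s z≤n) |w₁|<N ∘ sym)))
        where
        |w₁|<N : length w₁ < N
        |w₁|<N = <-≤-trans (m<m+n (length w₁) (s≤s z≤n)) (≤-reflexive lengths)
        lex : Less W (r t) t (t + length w₁) → Lex (r t) (window W t N) (window W (t + length w₁) N)
        lex less@(m , agr , lt) = less⇒lex {W = W} {r = r t} less m<N m<N
          where
          -- Suffixes that agree on a whole period agree everywhere, including at `m`.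
          m<N : m < N
          m<N with suc m ≤? N
          ... | yes le = le
          ... | no ¬le = contradiction (agree-N⇒~ {t} {t + length w₁} (λ k k<N → agr k (<-≤-trans k<N (≮⇒≥ ¬le))) m) (LtL⇒≢ (r t) lt)

  -- If `C k` also occurs at `j`, it and `C j` are both read from `j`, so one is a prefix of the
  -- other and they are equal. Shorter prefixes repeat by the branching condition.
  C-key : ∀ k → Key k (L k)
  C-key k = record { nonempty = length-positive (nonempty (c∈X (k mod N))) ; unique = unique ; repeated = repeated }
    where
    unique : Unique k (L k)
    unique j eq = mod⇒~ {k} {j} (c-injective ([ shorter , longer ]′ (≤-total (L k) (L j))))
      where
      C-at-j : C k ≡ window W j (L k)
      C-at-j = trans (C-window k) (sym eq)
      shorter : L k ≤ L j → C k ≡ C j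
      shorter le = prefix-free (c∈X _) (c∈X _)
        (subst₂ Prefix (sym C-at-j) (sym (C-window j)) (prefix-window {W = W} j le))
      longer : L j ≤ L k → C k ≡ C j
      longer le = sym (prefix-free (c∈X _) (c∈X _)
        (subst₂ Prefix (sym (C-window j)) (sym C-at-j) (prefix-window {W = W} j le)))
    repeated : ∀ {ℓ} → 1 ≤ ℓ → ℓ < L k → Repeated k ℓ
    repeated {ℓ} 1≤ℓ ℓ<L = from-pair (proj₂ code (C k) p (c∈X _) (window≢[] 1≤ℓ , p≢C , p-prefix))
      where
      p : Word n
      p = window W k ℓ
      p≢C : p ≢ C k
      p≢C eq = <-irrefl (window-lengths {W = W} {k} {k} (trans eq (C-window k))) ℓ<L
      p-prefix : Prefix p (C k)
      p-prefix = subst (Prefix p) (sym (C-window k)) (prefix-window {W = W} k (<⇒≤ ℓ<L))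
      at : ∀ i → i ≢ k mod N → Prefix p (c i) → Repeated k ℓ
      at i i≢k pre = toℕ i ,
        sym (trans (prefix⇒window p (toℕ i) (subst (Prefix p) (sym (C-toℕ i)) pre)) (cong (window W (toℕ i)) (length-window {W = W} k ℓ))) ,
        λ same → i≢k (sym (trans (~⇒mod {k} {toℕ i} same) (mod-toℕ i)))
      from-pair : (Σ (Word n) λ y → Σ (Word n) λ z → X y × X z × y ≢ z × Prefix p y × Prefix p z) → Repeated k ℓ
      from-pair (y , z , y∈ , z∈ , y≢z , p≤y , p≤z) with c-onto y y∈ | c-onto z z∈
      -- At least one of two distinct code words sits elsewhere on the cycle than `C k`.
      ... | i , refl | j , refl with i ≟ k mod N
      ...   | no i≢k = at i i≢k p≤y
      ...   | yes refl = at j (λ { refl → y≢z refl }) p≤z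

  -- Each position has exactly one key, namely its code word, so both sets consist of the keys.
  X⇔MT : ∀ u → X u ⇔ MT (window W 0 N) u
  X⇔MT u = mk⇔ to from
    where
    to : X u → MT (window W 0 N) u
    to u∈ with c-onto u u∈
    ... | i , refl = subst (MT (window W 0 N)) (trans (sym (C-window (toℕ i))) (C-toℕ i)) (key⇒MT (C-key (toℕ i)))
    from : MT (window W 0 N) u → X u
    from u∈ with MT⇒key u∈
    ... | i , ℓ , refl , key = subst X (trans (C-window i) (cong (window W i) (key-unique (C-key i) key))) (c∈X _)

theorem4 : (n : ℕ)
    → ((w : Word n) → UniversalLyndon n w → LexCode n (MT w) × Hamiltonian (MT w))
    × (2 ≤ n → (X : Word n → Set) → LexCode n X → Hamiltonian X
    → Σ (Word n) λ w → UniversalLyndon n w × (∀ u → X u ⇔ MT w u))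
theorem4 n = forward n , backward
  where
  backward : 2 ≤ n → (X : Word n → Set) → LexCode n X → Hamiltonian X
    → Σ (Word n) λ w → UniversalLyndon n w × (∀ u → X u ⇔ MT w u)
  backward 2≤n X code (K , c , c-injective , c∈X , c-onto , c-edge) = _ , universal , X⇔MT
    where open Converse 2≤n X code c c-injective c∈X c-onto c-edge
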